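{- Let $F$ be a graph and let $F'$ be a graph resulting from the deletion of a vertex from $F$. Let $c=c(n)$ be such that $\mathrm{ex}(n,K_{r-1},F')\le c\,n$ for every $n$. Then \[\mathrm{ex}_r(n,\text{Berge- }F)\le \max\left\{\frac{2c}{r}, 1 \right\} \mathrm{ex}(n,F).\]
   Context: All graphs and hypergraphs are finite and simple. The integer $r$ is the uniformity of the hypergraphs considered, and $K_{r-1}$ is the complete graph on $r-1$ vertices. A hypergraph $\mathcal{H}$ contains a Berge-$F$ (Berge copy of the graph $F$) if there are an injection $\varphi:V(F)\to V(\mathcal{H})$ and an injection $f:E(F)\to E(\mathcal{H})$ with $\{\varphi(u),\varphi(v)\}\subset f(uv)$ for every edge $uv\in E(F)$; otherwise it is Berge-$F$-free. $\mathrm{ex}_r(n,\text{Berge- }F)$ is the maximum number of hyperedges in an $n$-vertex $r$-uniform Berge-$F$-free hypergraph. A graph is $F$-free if it has no (not necessarily induced) subgraph isomorphic to $F$. $\mathrm{ex}(n,F)$ is the maximum number of edges, and $\mathrm{ex}(n,H,F)$ the maximum number of copies of the graph $H$, in an $n$-vertex $F$-free graph.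
   Formalization: The bound on ex(m,K_{r-1},F') is required as ≤ c(n)·m for all m ≤ n, not only for m = n (the pointwise version fails for non-monotone c); this includes constant and nondecreasing c. c(n) is rational, which loses nothing. -}

module Defs where

open import Data.Bool using (Bool; T; not)
open import Data.Fin using (Fin; _<_; _≟_; _<?_; punchIn)
open import Data.Fin.Subset using (Subset; ∣_∣) renaming (_∈_ to _∈ₛ_)
open import Data.Integer using (+_)
open import Data.List using (List; length; filter; allFin; cartesianProduct)
open import Data.List.Membership.Propositional using (_∈_)
open import Data.List.Relation.Unary.All using (All)
open import Data.List.Relation.Unary.Unique.Propositional using (Unique)
open import Data.Nat using (ℕ; suc; _≤_)
open import Data.Product using (Σ; ∃-syntax; _×_; _,_)
open import Data.Rational using (ℚ; _/_)
open import Function using (Injective; _⇔_; Bijection)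
open import Function.Properties.Equivalence using (⇔-isEquivalence)
open import Level using (0ℓ)
open import Relation.Binary using (Setoid; IsEquivalence)
open import Relation.Binary.PropositionalEquality using (_≡_; refl; sym; setoid)
open import Relation.Nullary using (¬_; ⌊_⌋; _×-dec_; yes; no)
open import Relation.Nullary.Decidable using (T?)

record Graph (n : ℕ) : Set where
  field
    adj       : Fin n → Fin n → Bool
    symmetric : ∀ {u v} → T (adj u v) → T (adj v u)
    loopless  : ∀ {u} → ¬ T (adj u u)

open Graph public

-- An unordered pair {u , v} is represented by its increasing ordering, so
-- that propositional equality of edges is equality of two-element sets.
record Edge {n : ℕ} (G : Graph n) : Set where
  field
    source   : Fin n
    target   : Fin n
    ordered  : source < target
    adjacent : T (adj G source target)

open Edge public

edgeList : ∀ {n} → Graph n → List (Fin n × Fin n)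
edgeList {n} G =
  filter (λ (u , v) → (u <? v) ×-dec T? (adj G u v))
         (cartesianProduct (allFin n) (allFin n))

#edges : ∀ {n} → Graph n → ℕ
#edges G = length (edgeList G)

complete : ∀ n → Graph n
complete n = record
  { adj       = λ u v → not ⌊ u ≟ v ⌋
  ; symmetric = λ {u} {v} → symm u v
  ; loopless  = λ {u} → irr u
  }
  where
  symm : ∀ u v → T (not ⌊ u ≟ v ⌋) → T (not ⌊ v ≟ u ⌋)
  symm u v p with u ≟ v | v ≟ u
  ... | no u≢v | yes v≡u = u≢v (sym v≡u)
  ... | no _   | no _    = _

  irr : ∀ u → ¬ T (not ⌊ u ≟ u ⌋)
  irr u p with u ≟ u
  ... | no u≢u = u≢u refl

deleteVertex : ∀ {n} → Graph (suc n) → Fin (suc n) → Graph n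
deleteVertex F v = record
  { adj       = λ x y → adj F (punchIn v x) (punchIn v y)
  ; symmetric = symmetric F
  ; loopless  = loopless F
  }

-- Adjacency is preserved but not reflected: subgraphs need not be induced.
record Embedding {h n : ℕ} (H : Graph h) (G : Graph n) : Set where
  field
    map       : Fin h → Fin n
    injective : Injective _≡_ _≡_ map
    preserves : ∀ {u v} → T (adj H u v) → T (adj G (map u) (map v))

open Embedding public

Free : ∀ {k n} → Graph k → Graph n → Set
Free F G = ¬ Embedding F G

-- Copies of H in G are the subgraphs of G isomorphic to H, that is, the
-- images of embeddings. Two embeddings give the same copy when their images
-- have the same vertices and the same edges.

module _ {h n : ℕ} {H : Graph h} {G : Graph n} where

  VertexOfImage : Embedding H G → Fin n → Set
  VertexOfImage φ x = ∃[ u ] map φ u ≡ x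

  EdgeOfImage : Embedding H G → Fin n → Fin n → Set
  EdgeOfImage φ x y =
    ∃[ u ] ∃[ v ] T (adj H u v) × map φ u ≡ x × map φ v ≡ y

  SameImage : Embedding H G → Embedding H G → Set
  SameImage φ ψ =
    (∀ x → VertexOfImage φ x ⇔ VertexOfImage ψ x) ×
    (∀ x y → EdgeOfImage φ x y ⇔ EdgeOfImage ψ x y)

  sameImage-isEquivalence : IsEquivalence SameImage
  sameImage-isEquivalence = record
    { refl  = (λ _ → E.refl) , (λ _ _ → E.refl)
    ; sym   = λ (p , q) → (λ x → E.sym (p x)) , (λ x y → E.sym (q x y))
    ; trans = λ (p , q) (p′ , q′) →
        (λ x → E.trans (p x) (p′ x)) , (λ x y → E.trans (q x y) (q′ x y))
    }
    where module E = IsEquivalence (⇔-isEquivalence {0ℓ})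

Copies : ∀ {h n} → Graph h → Graph n → Setoid 0ℓ 0ℓ
Copies H G = record
  { Carrier       = Embedding H G
  ; _≈_           = SameImage
  ; isEquivalence = sameImage-isEquivalence
  }

HasCopies : ∀ {h n} → Graph h → Graph n → ℕ → Set
HasCopies H G k = Bijection (setoid (Fin k)) (Copies H G)

record Hypergraph (r n : ℕ) : Set where
  field
    hyperedges : List (Subset n)
    distinct   : Unique hyperedges
    uniform    : All (λ e → ∣ e ∣ ≡ r) hyperedges

open Hypergraph public

#hyperedges : ∀ {r n} → Hypergraph r n → ℕ
#hyperedges H = length (hyperedges H)

record Berge {k r n : ℕ} (F : Graph k) (H : Hypergraph r n) : Set where
  field
    φ           : Fin k → Fin n
    φ-injective : Injective _≡_ _≡_ φ
    f           : Edge F → Subset n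
    f-hyperedge : ∀ e → f e ∈ hyperedges H
    f-injective : Injective _≡_ _≡_ f
    source∈     : ∀ e → φ (source e) ∈ₛ f e
    target∈     : ∀ e → φ (target e) ∈ₛ f e

BergeFree : ∀ {k r n} → Graph k → Hypergraph r n → Set
BergeFree F H = ¬ Berge F H

-- Extremal numbers are given as relations "the maximum exists and equals m".
-- The maximum does not exist exactly when no graph (or hypergraph) on n
-- vertices is free, which can happen only if the forbidden graph has no edges.

IsMaximum : (ℕ → Set) → ℕ → Set
IsMaximum P m = P m × (∀ k → P k → k ≤ m)

-- ex(n, F) = m
IsEx : ∀ {k} → ℕ → Graph k → ℕ → Set
IsEx n F = IsMaximum λ m → Σ (Graph n) λ G → Free F G × #edges G ≡ m

-- ex(n, H, F) = m
IsExCopies : ∀ {h k} → ℕ → Graph h → Graph k → ℕ → Set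
IsExCopies n H F = IsMaximum λ m → Σ (Graph n) λ G → Free F G × HasCopies H G m

-- ex_r(n, Berge-F) = m
IsExBerge : ∀ {k} → ℕ → ℕ → Graph k → ℕ → Set
IsExBerge r n F =
  IsMaximum λ m → Σ (Hypergraph r n) λ H → BergeFree F H × #hyperedges H ≡ m

fromℕ : ℕ → ℚ
fromℕ n = + n / 1

-- Match hyperedges to pairs of vertices they contain. König's theorem splits
-- the hyperedges into red and blue ones so that every blue hyperedge is matched
-- and every pair inside a red hyperedge is matched to a red hyperedge. The
-- matched pairs form an F-free graph, since an embedding of F into it is a
-- Berge copy of F; the blue hyperedges are no more than its edges outside the
-- graph R of the pairs lying in red hyperedges. Red hyperedges are cliques of R,
-- those through u give distinct copies of K_{r-1} in the link of u in R, and
-- this link is F'-free because R is F-free. Hence u lies in at most c·deg_R(u)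
-- red hyperedges, and summing over u bounds r times their number by 2c·e(R).
module Submission where

open import Defs
open import Data.Bool using (true; false; if_then_else_; T)
open import Data.Bool.Properties using (T?; T-irrelevant)
open import Data.Empty using () renaming (⊥ to Empty)
open import Data.Fin as Fin using (Fin; zero; suc; punchIn; punchOut; funToFin; finToFun; splitAt; join; _<?_)
open import Data.Fin.Properties as Fin using (any?; all?; injective⇒≤; suc-injective; punchIn-injective; punchInᵢ≢i; punchIn-punchOut; finToFun-funToFin; join-splitAt)
open import Data.Fin.Subset using (Subset; ∣_∣; ∁; _∪_; ⁅_⁆; _⊃_; ⊥; inside; outside) renaming (_∈_ to _∈ₛ_; _∉_ to _∉ₛ_)
open import Data.Fin.Subset.Induction using (⊃-wellFounded; Acc; acc)
open import Data.Fin.Subset.Properties using (_∈?_; x∈p∪q⁻; x∈p∪q⁺; x∈⁅x⁆; x∈⁅y⁆⇒x≡y; ∉⊥; ⊆-antisym; ∣∁p∣≡n∸∣p∣; ∣p∣≤n; x∈∁p⇒x∉p)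
open import Data.Integer as ℤ using (+_)
import Data.Integer.Properties as ℤ
open import Data.List using (List; []; _∷_; allFin; tabulate; filter; length; lookup; cartesianProduct; _++_) renaming (map to mapₗ)
open import Data.List.Membership.Propositional using (_∈_)
open import Data.List.Membership.Propositional.Properties using (∈-lookup; ∈-allFin; ∈-filter⁺; ∈-filter⁻; ∈-cartesianProduct⁺)
open import Data.List.Properties using (length-++; filter-++; map-tabulate)
import Data.List.Relation.Unary.All as All
open import Data.List.Relation.Unary.AllPairs using (_∷_)
open import Data.List.Relation.Unary.Any using (here; there; index)
open import Data.List.Relation.Unary.Any.Properties using (lookup-index)
open import Data.List.Relation.Unary.Unique.Propositional using (Unique)
open import Data.List.Relation.Unary.Unique.Propositional.Properties using (allFin⁺; cartesianProduct⁺; filter⁺)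
open import Data.Maybe using (Maybe; just; nothing)
open import Data.Maybe.Properties as Maybe using (just-injective)
open import Data.Nat as ℕ using (ℕ; zero; suc; _∸_; NonZero) renaming (_≤_ to _≤ℕ_)
import Data.Nat.Properties as ℕ
open import Data.Product using (∃; ∃-syntax; Σ-syntax; _×_; _,_; proj₁; proj₂; uncurry)
open import Data.Product.Properties using (≡-dec)
open import Data.Rational using (ℚ; _≤_; _*_; _+_; _⊔_; _/_; 1ℚ; toℚᵘ; NonNegative; nonNegative)
import Data.Rational.Properties as ℚ
open import Data.Rational.Solver using (module +-*-Solver)
import Data.Rational.Unnormalised as ℚᵘ
import Data.Rational.Unnormalised.Properties as ℚᵘ
open import Data.Sum using (_⊎_; inj₁; inj₂; [_,_]′)
open import Data.Vec using ([]; _∷_)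
open import Data.Vec.Functional using (updateAt; insertAt)
open import Data.Vec.Functional.Properties using (updateAt-updates; updateAt-minimal; insertAt-lookup; insertAt-punchIn)
open import Function using (id; const; _∘_; Injective; _⇔_; mk⇔; Equivalence; Bijection)
open import Level using (0ℓ)
open import Relation.Binary using (DecidableEquality; Setoid; tri<; tri≈; tri>)
open import Relation.Binary.PropositionalEquality
open import Relation.Nullary using (¬_; Dec; does; yes; no; ¬?; ⌊_⌋; _×-dec_; _⊎-dec_; _→-dec_; contradiction)
open import Relation.Nullary.Decidable using (decidable-stable; map′; dec-true; dec-false; toWitness; fromWitness)
open import Relation.Unary using (Pred; Decidable)
open import Algebra.Properties.Semiring.Sum ℕ.+-*-semiring using (sum; ∑-distrib-+; ∑-comm; sum-cong-≗; sum-replicate-zero; *-distribʳ-sum; sum-syntax)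

-- Alternating paths and König's theorem in bipartite graphs.

module König {m : ℕ} {B : Set}
  (_~_ : Fin m → B → Set) (_~?_ : ∀ a b → Dec (a ~ b))
  (_≟_ : DecidableEquality B)
  (search : ∀ {P : B → Set} → Decidable P → Dec (∃ P)) where

  record Matching : Set where
    field
      partner           : Fin m → Maybe B
      sound             : ∀ {a b} → partner a ≡ just b → a ~ b
      partner-injective : ∀ {a a′ b} → partner a ≡ just b → partner a′ ≡ just b → a ≡ a′

  open Matching public

  Saturated : Matching → Fin m → Set
  Saturated M a = ∃[ b ] partner M a ≡ just b

  Matched : Matching → B → Set
  Matched M b = ∃[ a ] partner M a ≡ just b

  updateAt-inverse : ∀ {p : Fin m → Maybe B} s {v w} a → updateAt p s (const v) a ≡ w →
                     (a ≡ s × v ≡ w) ⊎ (a ≢ s × p a ≡ w)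
  updateAt-inverse {p} s a eq with a Fin.≟ s
  ... | yes refl = inj₁ (refl , trans (sym (updateAt-updates s p)) eq)
  ... | no a≢s   = inj₂ (a≢s , trans (sym (updateAt-minimal a s p a≢s)) eq)

  unassign : Matching → Fin m → Matching
  unassign M s = record
    { partner   = updateAt (partner M) s (const nothing)
    ; sound     = λ {a} eq → sound M (old a eq)
    ; partner-injective = λ {a} {a′} eq eq′ → partner-injective M (old a eq) (old a′ eq′)
    }
    where
    old : ∀ {b} a → updateAt (partner M) s (const nothing) a ≡ just b → partner M a ≡ just b
    old a eq with updateAt-inverse s a eq
    ... | inj₂ (_ , eq′) = eq′

  -- `fresh` concerns only the vertices other than `s`, because whatever partner `s` had is
  -- overwritten.
  assign : ∀ M {s b} → s ~ b → (∀ {a} → a ≢ s → partner M a ≢ just b) → Matching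
  assign M {s} {b} s~b fresh = record
    { partner   = updateAt (partner M) s (const (just b))
    ; sound     = λ {a} → sound′ a
    ; partner-injective = λ {a} {a′} → injective′ a a′
    }
    where
    sound′ : ∀ a {b′} → updateAt (partner M) s (const (just b)) a ≡ just b′ → a ~ b′
    sound′ a eq with updateAt-inverse s a eq
    ... | inj₁ (refl , refl) = s~b
    ... | inj₂ (_ , eq′)     = sound M eq′
    injective′ : ∀ a a′ {b′} → updateAt (partner M) s (const (just b)) a ≡ just b′ →
                 updateAt (partner M) s (const (just b)) a′ ≡ just b′ → a ≡ a′
    injective′ a a′ eq eq′ with updateAt-inverse s a eq | updateAt-inverse s a′ eq′
    ... | inj₁ (refl , _)    | inj₁ (refl , _)    = refl
    ... | inj₁ (_ , refl)    | inj₂ (a′≢s , p)    = contradiction p (fresh a′≢s)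
    ... | inj₂ (a≢s , p)     | inj₁ (_ , refl)    = contradiction p (fresh a≢s)
    ... | inj₂ (_ , p)       | inj₂ (_ , p′)      = partner-injective M p p′

  -- The vertices in todo are exempt from the requirement on blue vertices.
  record Decomposition (todo : List (Fin m)) : Set where
    field
      matching : Matching
      red      : Subset m
      closed   : ∀ {a b} → a ∈ₛ red → a ~ b → ∃[ a′ ] a′ ∈ₛ red × partner matching a′ ≡ just b
      blue     : ∀ {a} → a ∉ₛ red → Saturated matching a ⊎ a ∈ todo

  -- The effect of switching M along an alternating path inside S that ends at s:
  -- s is freed in exchange for the vertex at the start of the path.
  record Reroute (M : Matching) (S : Subset m) (s : Fin m) : Set where
    field
      rerouted  : Matching
      saturated : ∀ {a} → a ∈ₛ S → a ≢ s → Saturated rerouted a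
      unchanged : ∀ {a} → a ∉ₛ S → partner rerouted a ≡ partner M a
      image     : ∀ {b} → Matched rerouted b → Matched M b

  module _ {a₀ todo} (D : Decomposition (a₀ ∷ todo)) where
    open Decomposition D

    dropHead : ∀ {a} {X : Set} → a ≢ a₀ → X ⊎ a ∈ a₀ ∷ todo → X ⊎ a ∈ todo
    dropHead a≢a₀ (inj₁ x)          = inj₁ x
    dropHead a≢a₀ (inj₂ (here eq))  = contradiction eq a≢a₀
    dropHead a≢a₀ (inj₂ (there a∈)) = inj₂ a∈

    ∉⇒≢ : ∀ {p : Subset m} {a b} → a ∉ₛ p → b ∈ₛ p → a ≢ b
    ∉⇒≢ a∉p b∈p refl = a∉p b∈p

    -- The alternating path to `s` is prolonged through `b` to its owner `a′`. A rerouting for some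
    -- `t` in `S` leaves `a′` with its partner `b`, so it still serves. To free `a′` itself, free
    -- `s` by `R` and hand `b` over from `a′` to `s`; since `b` was matched before, no new element
    -- of `B` becomes matched.
    extend : ∀ {S s b a′} → Reroute matching S s → s ∈ₛ S → s ~ b →
             partner matching a′ ≡ just b → a′ ∉ₛ S →
             ∀ {t} → t ∈ₛ S ∪ ⁅ a′ ⁆ → (∀ {t} → t ∈ₛ S → Reroute matching S t) →
             Reroute matching (S ∪ ⁅ a′ ⁆) t
    extend {S} {s} {b} {a′} R s∈S s~b a′↦b a′∉S {t} t∈S∪a′ reroute
      with x∈p∪q⁻ S ⁅ a′ ⁆ t∈S∪a′
    ... | inj₁ t∈S = record
      { rerouted  = rerouted
      ; saturated = saturated′
      ; unchanged = λ a∉ → unchanged (a∉ ∘ x∈p∪q⁺ ∘ inj₁)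
      ; image     = image
      }
      where
      open Reroute (reroute t∈S)
      saturated′ : ∀ {a} → a ∈ₛ S ∪ ⁅ a′ ⁆ → a ≢ t → Saturated rerouted a
      saturated′ a∈ a≢t with x∈p∪q⁻ S ⁅ a′ ⁆ a∈
      ... | inj₁ a∈S = saturated a∈S a≢t
      ... | inj₂ a∈a′ with refl ← x∈⁅y⁆⇒x≡y a′ a∈a′ = b , trans (unchanged a′∉S) a′↦b
    ... | inj₂ t∈a′ with refl ← x∈⁅y⁆⇒x≡y a′ t∈a′ = record
      { rerouted  = assign (unassign rerouted a′) s~b fresh
      ; saturated = saturated′
      ; unchanged = λ {a} a∉ →
          trans (updateAt-minimal a s _ λ { refl → a∉ (x∈p∪q⁺ (inj₁ s∈S)) })
         (trans (updateAt-minimal a a′ _ λ { refl → a∉ (x∈p∪q⁺ {p = S} (inj₂ (x∈⁅x⁆ a′))) })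
                (unchanged (a∉ ∘ x∈p∪q⁺ ∘ inj₁)))
      ; image     = image′
      }
      where
      open Reroute R
      -- Since `a′` lies outside `S`, it still owns `b` after rerouting, and once it is unassigned
      -- nobody does.
      fresh : ∀ {a} → a ≢ s → partner (unassign rerouted a′) a ≢ just b
      fresh {a} _ eq with updateAt-inverse a′ a eq
      ... | inj₂ (a≢a′ , a↦b) =
        a≢a′ (partner-injective rerouted a↦b (trans (unchanged a′∉S) a′↦b))

      final : Matching
      final = assign (unassign rerouted a′) s~b fresh

      saturated′ : ∀ {a} → a ∈ₛ S ∪ ⁅ a′ ⁆ → a ≢ a′ → Saturated final a
      saturated′ {a} a∈ a≢a′ with x∈p∪q⁻ S ⁅ a′ ⁆ a∈ | a Fin.≟ s
      ... | inj₂ a∈a′ | _        = contradiction (x∈⁅y⁆⇒x≡y a′ a∈a′) a≢a′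
      ... | inj₁ _    | yes refl = b , updateAt-updates s _
      ... | inj₁ a∈S  | no a≢s   =
        let c , a↦c = saturated a∈S a≢s
        in c , trans (updateAt-minimal a s _ a≢s) (trans (updateAt-minimal a a′ _ a≢a′) a↦c)

      image′ : ∀ {c} → Matched final c → Matched matching c
      image′ (a , eq) with updateAt-inverse s a eq
      ... | inj₁ (refl , refl) = a′ , a′↦b
      ... | inj₂ (_ , eq′) with updateAt-inverse a′ a eq′
      ...   | inj₂ (_ , eq″) = image (a , eq″)

    -- `S` collects non-red vertices reached from `a₀` by alternating paths. An exit is a neighbour
    -- `b` of some `s` in `S` that is not the partner of any vertex of `red ∪ S`. Without an exit
    -- all of `S` can turn red. An exit owned by `a′` enlarges `S` by `a′`, which can happen only
    -- finitely often. An unmatched exit completes an augmenting path, and `red` stays as it is.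
    explore : ∀ {S} → Acc _⊃_ S → a₀ ∈ₛ S → (∀ {a} → a ∈ₛ S → a ∉ₛ red) →
              (∀ {s} → s ∈ₛ S → Reroute matching S s) → Decomposition todo
    explore {S} (acc rec) a₀∈S disjoint reroute
      with any? (λ s → (s ∈? S) ×-dec search (λ b → (s ~? b) ×-dec
             ¬? (any? λ a → (a ∈? red ∪ S) ×-dec Maybe.≡-dec _≟_ (partner matching a) (just b))))
    ... | no stuck = record
      { matching = matching
      ; red      = red ∪ S
      ; closed   = closed′
      ; blue     = λ a∉ → dropHead (∉⇒≢ a∉ (x∈p∪q⁺ (inj₂ a₀∈S))) (blue (a∉ ∘ x∈p∪q⁺ ∘ inj₁))
      }
      where
      closed′ : ∀ {a b} → a ∈ₛ red ∪ S → a ~ b →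
                ∃[ a′ ] a′ ∈ₛ red ∪ S × partner matching a′ ≡ just b
      closed′ {a} {b} a∈ a~b with x∈p∪q⁻ red S a∈
      ... | inj₁ a∈red = let a′ , a′∈red , eq = closed a∈red a~b
                         in a′ , x∈p∪q⁺ (inj₁ a′∈red) , eq
      ... | inj₂ a∈S = decidable-stable
        (any? λ a → (a ∈? red ∪ S) ×-dec Maybe.≡-dec _≟_ (partner matching a) (just b))
        (λ ¬p → stuck (a , a∈S , b , a~b , ¬p))
    ... | yes (s , s∈S , b , s~b , exit)
      with any? (λ a → Maybe.≡-dec _≟_ (partner matching a) (just b))
    ...   | yes (a′ , a′↦b) = explore
      (rec ((x∈p∪q⁺ ∘ inj₁) , a′ , x∈p∪q⁺ {p = S} (inj₂ (x∈⁅x⁆ a′)) , a′∉S))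
      (x∈p∪q⁺ (inj₁ a₀∈S))
      (λ a∈ → [ disjoint , (λ a∈a′ a∈red → a′∉red (subst (_∈ₛ red) (x∈⁅y⁆⇒x≡y a′ a∈a′) a∈red)) ]′
                (x∈p∪q⁻ S ⁅ a′ ⁆ a∈))
      (λ t∈ → extend (reroute s∈S) s∈S s~b a′↦b a′∉S t∈ reroute)
      where
      a′∉S : a′ ∉ₛ S
      a′∉S a′∈S = exit (a′ , x∈p∪q⁺ (inj₂ a′∈S) , a′↦b)
      a′∉red : a′ ∉ₛ red
      a′∉red a′∈red = exit (a′ , x∈p∪q⁺ (inj₁ a′∈red) , a′↦b)
    ...   | no unmatched = record
      { matching = final
      ; red      = red
      ; closed   = closed′
      ; blue     = blue′
      }
      where
      open Reroute (reroute s∈S)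
      final : Matching
      final = assign rerouted s~b λ {a} _ eq → unmatched (image (a , eq))
      -- The path was switched inside `S`, which is disjoint from `red`, so red vertices keep their
      -- partners.
      closed′ : ∀ {a c} → a ∈ₛ red → a ~ c → ∃[ a′ ] a′ ∈ₛ red × partner final a′ ≡ just c
      closed′ a∈red a~c with a′ , a′∈red , eq ← closed a∈red a~c =
        a′ , a′∈red ,
        trans (updateAt-minimal a′ s _ λ { refl → disjoint s∈S a′∈red })
              (trans (unchanged λ a′∈S → disjoint a′∈S a′∈red) eq)
      blue′ : ∀ {a} → a ∉ₛ red → Saturated final a ⊎ a ∈ todo
      blue′ {a} a∉red with a Fin.≟ s
      ... | yes refl = inj₁ (b , updateAt-updates s _)
      ... | no a≢s with a ∈? S
      ...   | yes a∈S = let c , eq = saturated a∈S a≢s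
                        in inj₁ (c , trans (updateAt-minimal a s _ a≢s) eq)
      ...   | no a∉S with dropHead (∉⇒≢ a∉S a₀∈S) (blue a∉red)
      ...     | inj₁ (c , eq) =
        inj₁ (c , trans (updateAt-minimal a s _ a≢s) (trans (unchanged a∉S) eq))
      ...     | inj₂ a∈       = inj₂ a∈

    process : Decomposition todo
    process with a₀ ∈? red
    ... | yes a₀∈red = record
      { matching = matching
      ; red      = red
      ; closed   = closed
      ; blue     = λ a∉ → dropHead (∉⇒≢ a∉ a₀∈red) (blue a∉)
      }
    -- The search starts with the path consisting of `a₀` alone. The current matching is its own
    -- rerouting, as `⁅ a₀ ⁆` has no other vertex to saturate.
    ... | no a₀∉red = explore (⊃-wellFounded _) (x∈⁅x⁆ a₀)
      (λ a∈ a∈red → a₀∉red (subst (_∈ₛ red) (x∈⁅y⁆⇒x≡y a₀ a∈) a∈red))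
      λ s∈ → record
        { rerouted  = matching
        ; saturated = λ a∈ a≢s → contradiction (trans (x∈⁅y⁆⇒x≡y a₀ a∈) (sym (x∈⁅y⁆⇒x≡y a₀ s∈))) a≢s
        ; unchanged = λ _ → refl
        ; image     = λ p → p
        }

  abstract
    -- With the empty matching, no red vertex and every vertex exempt, all conditions hold
    -- trivially; each round lifts one exemption. In the end the blue vertices together with the
    -- neighbours of red vertices form a vertex cover that has exactly one end of each matching edge
    -- for its elements, as in König's theorem.
    decompose : Decomposition []
    decompose = go (allFin m) record
      { matching = record { partner = const nothing ; sound = λ () ; partner-injective = λ () }
      ; red      = ⊥
      ; closed   = λ a∈ → contradiction a∈ ∉⊥
      ; blue     = λ {a} _ → inj₂ (∈-allFin a)
      }
      where
      go : ∀ todo → Decomposition todo → Decomposition []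
      go []         D = D
      go (_ ∷ todo) D = go todo (process D)

-- Indicator sums, numberings of finite sets and the handshake identity.

𝟙 : {P : Set} → Dec P → ℕ
𝟙 P? = if does P? then 1 else 0

𝟙-cong : {P Q : Set} (P? : Dec P) (Q? : Dec Q) → P ⇔ Q → 𝟙 P? ≡ 𝟙 Q?
𝟙-cong (yes p) Q? P⇔Q rewrite dec-true Q? (Equivalence.to P⇔Q p) = refl
𝟙-cong (no ¬p) Q? P⇔Q rewrite dec-false Q? (¬p ∘ Equivalence.from P⇔Q) = refl

𝟙-no : {P : Set} (P? : Dec P) → ¬ P → 𝟙 P? ≡ 0
𝟙-no P? ¬p rewrite dec-false P? ¬p = refl

length-filter-tabulate : ∀ {A : Set} {n} {P : Pred A 0ℓ} (P? : Decidable P) (f : Fin n → A) →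
                         length (filter P? (tabulate f)) ≡ ∑[ i < n ] 𝟙 (P? (f i))
length-filter-tabulate {n = zero}  P? f = refl
length-filter-tabulate {n = suc n} P? f with does (P? (f zero))
... | true  = cong suc (length-filter-tabulate P? (f ∘ suc))
... | false = length-filter-tabulate P? (f ∘ suc)

length-filter-cartesianProduct :
  ∀ {A B : Set} {m n} {P : Pred (A × B) 0ℓ} (P? : Decidable P) (f : Fin m → A) (g : Fin n → B) →
  length (filter P? (cartesianProduct (tabulate f) (tabulate g))) ≡
  ∑[ i < m ] ∑[ j < n ] 𝟙 (P? (f i , g j))
length-filter-cartesianProduct {m = zero}      P? f g = refl
length-filter-cartesianProduct {m = suc m} {n} P? f g = begin
  length (filter P? (row ++ rest))                     ≡⟨ cong length (filter-++ P? row rest) ⟩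
  length (filter P? row ++ filter P? rest)             ≡⟨ length-++ (filter P? row) ⟩
  length (filter P? row) ℕ.+ length (filter P? rest)
    ≡⟨ cong₂ ℕ._+_ (trans (cong (length ∘ filter P?) (map-tabulate g (f zero ,_)))
                        (length-filter-tabulate P? (λ j → f zero , g j)))
                 (length-filter-cartesianProduct P? (f ∘ suc) g) ⟩
  ∑[ i < suc m ] ∑[ j < n ] 𝟙 (P? (f i , g j))         ∎
  where
  open ≡-Reasoning
  row  = mapₗ (f zero ,_) (tabulate g)
  rest = cartesianProduct (tabulate (f ∘ suc)) (tabulate g)

∣p∣≡∑𝟙 : ∀ {n} (p : Subset n) → ∣ p ∣ ≡ ∑[ x < n ] 𝟙 (x ∈? p)
∣p∣≡∑𝟙 []            = refl
∣p∣≡∑𝟙 (inside ∷ p)  = cong suc (∣p∣≡∑𝟙 p)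
∣p∣≡∑𝟙 (outside ∷ p) = ∣p∣≡∑𝟙 p

lookup-injective : {A : Set} {xs : List A} → Unique xs → Injective _≡_ _≡_ (lookup xs)
lookup-injective (_ ∷ _)    {zero}  {zero}  _  = refl
lookup-injective (x∉xs ∷ _) {zero}  {suc j} eq = contradiction eq (All.lookup x∉xs (∈-lookup j))
lookup-injective (x∉xs ∷ _) {suc i} {zero}  eq = contradiction (sym eq) (All.lookup x∉xs (∈-lookup i))
lookup-injective (_ ∷ uniq) {suc i} {suc j} eq = cong suc (lookup-injective uniq eq)

record Enumeration {n : ℕ} (P : Pred (Fin n) 0ℓ) (k : ℕ) : Set where
  field
    at         : Fin k → Fin n
    at-injective : Injective _≡_ _≡_ at
    satisfies  : ∀ i → P (at i)
    surjective : ∀ {x} → P x → ∃[ i ] at i ≡ x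

-- A bridge between two views of cardinality: indicator sums are suited to double counting,
-- numberings by `Fin` to building injections and embeddings.
enumerate : ∀ {n} {P : Pred (Fin n) 0ℓ} (P? : Decidable P) → Enumeration P (∑[ x < n ] 𝟙 (P? x))
enumerate {zero}  P? = record
  { at = λ () ; at-injective = λ {} ; satisfies = λ () ; surjective = λ { {()} } }
enumerate {suc n} {P} P? with P? zero
... | no ¬p = record
  { at         = suc ∘ at
  ; at-injective = at-injective ∘ suc-injective
  ; satisfies  = satisfies
  ; surjective = surj
  }
  where
  open Enumeration (enumerate (P? ∘ suc))
  surj : ∀ {x} → P x → ∃[ i ] suc (at i) ≡ x
  surj {zero}  p  = contradiction p ¬p
  surj {suc x} px = let i , eq = surjective px in i , cong suc eq
... | yes p = record
  { at         = at′
  ; at-injective = inj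
  ; satisfies  = λ { zero → p ; (suc i) → satisfies i }
  ; surjective = surj
  }
  where
  open Enumeration (enumerate (P? ∘ suc))
  at′ : Fin (suc (sum λ x → 𝟙 (P? (suc x)))) → Fin (suc n)
  at′ zero    = zero
  at′ (suc i) = suc (at i)
  inj : Injective _≡_ _≡_ at′
  inj {zero}  {zero}  _  = refl
  inj {suc i} {suc j} eq = cong suc (at-injective (suc-injective eq))
  surj : ∀ {x} → P x → ∃[ i ] at′ i ≡ x
  surj {zero}  _  = zero , refl
  surj {suc x} px = let i , eq = surjective px in suc i , cong suc eq

enumerateSubset : ∀ {n} (p : Subset n) → Enumeration (_∈ₛ p) ∣ p ∣
enumerateSubset p = subst (Enumeration (_∈ₛ p)) (sym (∣p∣≡∑𝟙 p)) (enumerate (_∈? p))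

degree : ∀ {n} → Graph n → Fin n → ℕ
degree {n} G u = ∑[ w < n ] 𝟙 (T? (adj G u w))

neighbours : ∀ {n} (G : Graph n) u → Enumeration (λ w → T (adj G u w)) (degree G u)
neighbours G u = enumerate (λ w → T? (adj G u w))

-- An adjacent ordered pair is either increasing or decreasing. Exchanging the two sums turns the
-- decreasing pairs into increasing ones, and the increasing ones are what `edgeList` lists.
handshake : ∀ {n} (G : Graph n) → ∑[ u < n ] degree G u ≡ 2 ℕ.* #edges G
handshake {n} G = begin
  ∑[ u < n ] ∑[ w < n ] 𝟙 (T? (adj G u w))
    ≡⟨ sum-cong-≗ (λ u → trans (sum-cong-≗ (split u)) (∑-distrib-+ (up u) (λ w → up w u))) ⟩
  ∑[ u < n ] (∑[ w < n ] up u w ℕ.+ ∑[ w < n ] up w u)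
    ≡⟨ ∑-distrib-+ (λ u → ∑[ w < n ] up u w) (λ u → ∑[ w < n ] up w u) ⟩
  ∑[ u < n ] ∑[ w < n ] up u w ℕ.+ ∑[ u < n ] ∑[ w < n ] up w u
    ≡⟨ cong₂ ℕ._+_ refl (∑-comm (λ u w → up w u)) ⟩
  ∑[ u < n ] ∑[ w < n ] up u w ℕ.+ ∑[ u < n ] ∑[ w < n ] up u w
    ≡⟨ cong₂ ℕ._+_ (sym edges) (trans (sym edges) (sym (ℕ.+-identityʳ _))) ⟩
  2 ℕ.* #edges G ∎
  where
  open ≡-Reasoning
  up? : ∀ u w → Dec (u Fin.< w × T (adj G u w))
  up? u w = (u <? w) ×-dec T? (adj G u w)
  up : Fin n → Fin n → ℕ
  up u w = 𝟙 (up? u w)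
  edges : #edges G ≡ ∑[ u < n ] ∑[ w < n ] up u w
  edges = length-filter-cartesianProduct (uncurry up?) (id {A = Fin n}) (id {A = Fin n})
  split : ∀ u w → 𝟙 (T? (adj G u w)) ≡ up u w ℕ.+ up w u
  split u w with Fin.<-cmp u w
  ... | tri< u<w _ w≮u = trans (𝟙-cong (T? (adj G u w)) (up? u w) (mk⇔ (u<w ,_) proj₂))
    (sym (trans (cong (up u w ℕ.+_) (𝟙-no (up? w u) (w≮u ∘ proj₁))) (ℕ.+-identityʳ _)))
  ... | tri≈ u≮u refl _ = trans (𝟙-no (T? (adj G u u)) (loopless G))
    (sym (cong₂ ℕ._+_ (𝟙-no (up? u u) (u≮u ∘ proj₁)) (𝟙-no (up? u u) (u≮u ∘ proj₁))))
  ... | tri> u≮w _ w<u =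
    trans (𝟙-cong (T? (adj G u w)) (up? w u) (mk⇔ (λ uw → w<u , symmetric G uw) (symmetric G ∘ proj₂)))
          (sym (cong (ℕ._+ up w u) (𝟙-no (up? u w) (u≮w ∘ proj₁))))

-- Maxima and numbers of copies.

-- `P` is not assumed decidable, so a maximum can only be shown not to be absent: if `k` is not
-- maximal, some larger value satisfies `P`, and the bound `b` stops the ascent.
¬¬-maximum : ∀ {P : ℕ → Set} b → (∀ k → P k → k ≤ℕ b) → ∀ {k} → P k →
             ¬ ¬ (∃[ m ] k ≤ℕ m × IsMaximum P m)
¬¬-maximum {P} b bounded {k} = go b (ℕ.m≤m+n b k)
  where
  -- `d` bounds the room left between `k` and `b`; every ascent to a larger value uses up at least
  -- one unit of it.
  go : ∀ d {k} → b ≤ℕ d ℕ.+ k → P k → ¬ ¬ (∃[ m ] k ≤ℕ m × IsMaximum P m)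
  go zero    b≤k pk none = none (_ , ℕ.≤-refl , pk , λ k′ pk′ → ℕ.≤-trans (bounded k′ pk′) b≤k)
  go (suc d) {k} b≤ pk none = none (_ , ℕ.≤-refl , pk , λ k′ pk′ →
    decidable-stable (k′ ℕ.≤? k) λ k′≰k →
      let k<k′ = ℕ.≰⇒> k′≰k in
      go d (ℕ.≤-trans b≤ (ℕ.≤-trans (ℕ.≤-reflexive (sym (ℕ.+-suc d k))) (ℕ.+-monoʳ-≤ d k<k′))) pk′
        λ (m , k′≤m , max) → none (m , ℕ.≤-trans (ℕ.<⇒≤ k<k′) k′≤m , max))

module _ {h n : ℕ} {H : Graph h} {G : Graph n} where

  sameMap⇒sameImage : (φ ψ : Embedding H G) → (∀ u → map φ u ≡ map ψ u) → SameImage φ ψ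
  sameMap⇒sameImage φ ψ same =
    (λ x → mk⇔ (λ { (u , refl) → u , sym (same u) }) (λ { (u , refl) → u , same u })) ,
    (λ x y → mk⇔ (λ { (u , w , uw , refl , refl) → u , w , uw , sym (same u) , sym (same w) })
                 (λ { (u , w , uw , refl , refl) → u , w , uw , same u , same w }))

  _⇔?_ : {P Q : Set} → Dec P → Dec Q → Dec (P ⇔ Q)
  P? ⇔? Q? = map′ (uncurry mk⇔) (λ e → Equivalence.to e , Equivalence.from e)
                  ((P? →-dec Q?) ×-dec (Q? →-dec P?))

  -- Makes it decidable whether a finite family already contains a given copy.
  sameImage? : (φ ψ : Embedding H G) → Dec (SameImage φ ψ)
  sameImage? φ ψ =
    all? (λ x → vertex? φ x ⇔? vertex? ψ x) ×-dec
    all? (λ x → all? λ y → edge? φ x y ⇔? edge? ψ x y)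
    where
    vertex? : ∀ χ x → Dec (VertexOfImage χ x)
    vertex? χ x = any? λ u → map χ u Fin.≟ x
    edge? : ∀ χ x y → Dec (EdgeOfImage χ x y)
    edge? χ x y = any? λ u → any? λ w →
      T? (adj H u w) ×-dec (map χ u Fin.≟ x) ×-dec (map χ w Fin.≟ y)

-- A lower bound `k` on the number of copies, whereas `HasCopies` fixes the number exactly.
DistinctCopies : ∀ {h n} → Graph h → Graph n → ℕ → Set
DistinctCopies H G k =
  Σ[ f ∈ (Fin k → Embedding H G) ] (∀ {i j} → SameImage (f i) (f j) → i ≡ j)

hasCopies⇒distinctCopies : ∀ {h n} {H : Graph h} {G : Graph n} {k} → HasCopies H G k → DistinctCopies H G k
hasCopies⇒distinctCopies bij = Bijection.to bij , Bijection.injective bij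

-- Embeddings with the same vertex map have the same image, so distinct copies have distinct codes
-- among the `n ^ h` maps.
distinctCopies-bound : ∀ {h n} {H : Graph h} {G : Graph n} {k} → DistinctCopies H G k → k ≤ℕ n ℕ.^ h
distinctCopies-bound (f , distinct) = injective⇒≤ {f = λ i → funToFin (map (f i))} λ {i} {j} eq →
  distinct (sameMap⇒sameImage (f i) (f j) λ u →
    trans (sym (finToFun-funToFin (map (f i)) u))
   (trans (cong (λ c → finToFun c u) eq) (finToFun-funToFin (map (f j)) u)))

-- A copy missed by a maximum family of distinct copies would enlarge it.
maximum⇒hasCopies : ∀ {h n} {H : Graph h} {G : Graph n} {k} →
                    IsMaximum (DistinctCopies H G) k → HasCopies H G k
maximum⇒hasCopies {H = H} {G} {k} ((f , distinct) , maximal) = record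
  { to        = f
  ; cong      = λ {i} → λ { refl → ≈-refl {f i} }
  ; bijective = distinct , λ φ → let i , same = covered φ in i , λ { refl → same }
  }
  where
  open Setoid (Copies H G) using () renaming (refl to ≈-refl; sym to ≈-sym)
  covered : ∀ φ → ∃[ i ] SameImage (f i) φ
  covered φ with any? (λ i → sameImage? (f i) φ)
  ... | yes c = c
  ... | no missed = contradiction (maximal (suc k) (f′ , λ {i} {j} → distinct′ i j)) ℕ.1+n≰n
    where
    f′ : Fin (suc k) → Embedding H G
    f′ zero    = φ
    f′ (suc i) = f i
    distinct′ : ∀ i j → SameImage (f′ i) (f′ j) → i ≡ j
    distinct′ zero    zero    _    = refl
    distinct′ zero    (suc j) same = contradiction (j , ≈-sym {φ} {f j} same) missed
    distinct′ (suc i) zero    same = contradiction (i , same) missed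
    distinct′ (suc i) (suc j) same = cong suc (distinct same)

-- The double negation replaces an enumeration of all graphs; it is harmless
-- because the inequality derived from it is decidable.
distinctCopies≤ex : ∀ {h k n d} {H : Graph h} {F : Graph k} {G : Graph n} →
                    Free F G → DistinctCopies H G d → ¬ ¬ (∃[ x ] d ≤ℕ x × IsExCopies n H F x)
distinctCopies≤ex {h} {n = n} {G = G} free copies none =
  ¬¬-maximum (n ℕ.^ h) (λ _ → distinctCopies-bound) copies λ (c , d≤c , max) →
  ¬¬-maximum (n ℕ.^ h) (λ _ (_ , _ , hasCopies) → distinctCopies-bound (hasCopies⇒distinctCopies hasCopies))
    (G , free , maximum⇒hasCopies max) λ (x , c≤x , isEx) →
  none (x , ℕ.≤-trans d≤c c≤x , isEx)

-- Links of vertices, and cliques through a vertex.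

-- The subgraph induced on the neighbourhood of `u`, renumbered so that its order is the degree of
-- `u`. A bound linear in the order thus becomes one linear in the degree.
link : ∀ {n} (G : Graph n) (u : Fin n) → Graph (degree G u)
link G u = record
  { adj       = λ i j → adj G (at i) (at j)
  ; symmetric = symmetric G
  ; loopless  = loopless G
  }
  where open Enumeration (neighbours G u)

-- Since `u` is adjacent to its whole link, sending the deleted vertex `v` to `u` would extend a
-- copy of `deleteVertex F v` in the link to a copy of `F` in `G`.
link-free : ∀ {k n} (F : Graph (suc k)) (v : Fin (suc k)) (G : Graph n) u →
            Free F G → Free (deleteVertex F v) (link G u)
link-free {k} {n} F v G u free ψ = free record
  { map       = map′′
  ; injective = λ {x} {y} → inj x y
  ; preserves = λ {x} {y} → pres x y
  }
  where
  open Enumeration (neighbours G u)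
  map′′ : Fin (suc k) → Fin n
  map′′ = insertAt (at ∘ map ψ) v u
  map-v : map′′ v ≡ u
  map-v = insertAt-lookup _ v u
  map-punchIn : ∀ y → map′′ (punchIn v y) ≡ at (map ψ y)
  map-punchIn = insertAt-punchIn _ v u
  data View : Fin (suc k) → Set where
    deleted : View v
    kept    : ∀ y → View (punchIn v y)
  view : ∀ x → View x
  view x with v Fin.≟ x
  ... | yes refl = deleted
  ... | no v≢x   = subst View (punchIn-punchOut v≢x) (kept (punchOut v≢x))
  adjacent-u : ∀ y → T (adj G u (map′′ (punchIn v y)))
  adjacent-u y = subst (T ∘ adj G u) (sym (map-punchIn y)) (satisfies (map ψ y))
  map-v≢ : ∀ y → map′′ v ≢ map′′ (punchIn v y)
  map-v≢ y eq = loopless G (subst (T ∘ adj G u) (trans (sym eq) map-v) (adjacent-u y))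
  inj : ∀ x y → map′′ x ≡ map′′ y → x ≡ y
  inj x y eq with view x | view y
  ... | deleted | deleted = refl
  ... | deleted | kept y′ = contradiction eq (map-v≢ y′)
  ... | kept x′ | deleted = contradiction (sym eq) (map-v≢ x′)
  ... | kept x′ | kept y′ = cong (punchIn v) (Embedding.injective ψ (at-injective
    (trans (sym (map-punchIn x′)) (trans eq (map-punchIn y′)))))
  pres : ∀ x y → T (adj F x y) → T (adj G (map′′ x) (map′′ y))
  pres x y xy with view x | view y
  ... | deleted | deleted = contradiction xy (loopless F)
  ... | deleted | kept y′ = subst (λ z → T (adj G z (map′′ (punchIn v y′)))) (sym map-v) (adjacent-u y′)
  ... | kept x′ | deleted =
    symmetric G (subst (λ z → T (adj G z (map′′ (punchIn v x′)))) (sym map-v) (adjacent-u x′))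
  ... | kept x′ | kept y′ =
    subst₂ (λ a b → T (adj G a b)) (sym (map-punchIn x′)) (sym (map-punchIn y′)) (preserves ψ xy)

IsClique : ∀ {n} → Graph n → Subset n → Set
IsClique G p = ∀ {x y} → x ∈ₛ p → y ∈ₛ p → x ≢ y → T (adj G x y)

-- The vertices of `p` other than `u` are pairwise adjacent neighbours of `u`. The equivalence
-- recovers `p` from the vertices of the copy, so different cliques through `u` will give different
-- copies.
clique⇒copyInLink : ∀ {n k} (G : Graph n) {u} (p : Subset n) → ∣ p ∣ ≡ suc k → IsClique G p → u ∈ₛ p →
  Σ[ φ ∈ Embedding (complete k) (link G u) ]
  (∀ x → x ∈ₛ p ⇔ (x ≡ u ⊎ ∃[ i ] VertexOfImage φ i × Enumeration.at (neighbours G u) i ≡ x))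
clique⇒copyInLink {n} {k} G {u} p size clique u∈p = φ , λ x → mk⇔ (to x) (from x)
  where
  module N = Enumeration (neighbours G u)
  open Enumeration (subst (Enumeration (_∈ₛ p)) size (enumerateSubset p))
  -- `i₀` is the index of `u`; `punchIn i₀` skips it, so that `rest` numbers the other vertices of
  -- `p`.
  i₀   = proj₁ (surjective u∈p)
  at-i₀ : at i₀ ≡ u
  at-i₀ = proj₂ (surjective u∈p)
  rest : Fin k → Fin n
  rest j = at (punchIn i₀ j)
  u≢rest : ∀ j → u ≢ rest j
  u≢rest j eq = punchInᵢ≢i i₀ j (at-injective (trans (sym eq) (sym at-i₀)))
  position : ∀ j → ∃[ i ] N.at i ≡ rest j
  position j = N.surjective (clique u∈p (satisfies _) (u≢rest j))
  place = proj₁ ∘ position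
  at-place : ∀ j → N.at (place j) ≡ rest j
  at-place = proj₂ ∘ position
  rest-injective : Injective _≡_ _≡_ rest
  rest-injective eq = punchIn-injective i₀ _ _ (at-injective eq)
  φ : Embedding (complete k) (link G u)
  φ = record
    { map       = place
    ; injective = λ {i} {j} eq →
        rest-injective (trans (sym (at-place i)) (trans (cong N.at eq) (at-place j)))
    ; preserves = λ {i} {j} i≢j → subst₂ (λ a b → T (adj G a b)) (sym (at-place i)) (sym (at-place j))
        (clique (satisfies _) (satisfies _) λ eq →
          loopless (complete k) (subst (T ∘ adj (complete k) i) (sym (rest-injective eq)) i≢j))
    }
  to : ∀ x → x ∈ₛ p → x ≡ u ⊎ ∃[ i ] VertexOfImage φ i × N.at i ≡ x
  to x x∈p with surjective x∈p
  ... | i , refl with i₀ Fin.≟ i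
  ...   | yes refl = inj₁ at-i₀
  ...   | no i₀≢i  = inj₂ (place j , (j , refl) , trans (at-place j) (cong at (punchIn-punchOut i₀≢i)))
    where j = punchOut i₀≢i
  from : ∀ x → x ≡ u ⊎ (∃[ i ] VertexOfImage φ i × N.at i ≡ x) → x ∈ₛ p
  from x (inj₁ refl)                      = u∈p
  from x (inj₂ (_ , (j , refl) , refl)) = subst (_∈ₛ p) (sym (at-place j)) (satisfies _)

-- Rational arithmetic of the final estimate.

-- `fromℕ` normalises by a gcd that does not compute on variables; its laws are therefore carried
-- over from this unnormalised form.
ι : ℕ → ℚᵘ.ℚᵘ
ι n = ℚᵘ.mkℚᵘ (+ n) 0

toℚᵘ-fromℕ : ∀ n → toℚᵘ (fromℕ n) ℚᵘ.≃ ι n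
toℚᵘ-fromℕ n = ℚ.toℚᵘ-fromℚᵘ (ι n)

fromℕ-+ : ∀ a b → fromℕ (a ℕ.+ b) ≡ fromℕ a + fromℕ b
fromℕ-+ a b = ℚ.toℚᵘ-injective (begin-equality
  toℚᵘ (fromℕ (a ℕ.+ b))              ≃⟨ toℚᵘ-fromℕ (a ℕ.+ b) ⟩
  ι (a ℕ.+ b)
    ≃⟨ ℚᵘ.*≡* (cong (ℤ._* + 1) (sym (cong₂ ℤ._+_ (ℤ.*-identityʳ (+ a)) (ℤ.*-identityʳ (+ b))))) ⟩
  ι a ℚᵘ.+ ι b                        ≃⟨ ℚᵘ.+-cong (toℚᵘ-fromℕ a) (toℚᵘ-fromℕ b) ⟨
  toℚᵘ (fromℕ a) ℚᵘ.+ toℚᵘ (fromℕ b)  ≃⟨ ℚ.toℚᵘ-homo-+ (fromℕ a) (fromℕ b) ⟨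
  toℚᵘ (fromℕ a + fromℕ b)            ∎)
  where open ℚᵘ.≤-Reasoning

fromℕ-* : ∀ a b → fromℕ (a ℕ.* b) ≡ fromℕ a * fromℕ b
fromℕ-* a b = ℚ.toℚᵘ-injective (begin-equality
  toℚᵘ (fromℕ (a ℕ.* b))              ≃⟨ toℚᵘ-fromℕ (a ℕ.* b) ⟩
  ι (a ℕ.* b)                         ≃⟨ ℚᵘ.*≡* (cong (ℤ._* + 1) (ℤ.pos-* a b)) ⟩
  ι a ℚᵘ.* ι b                        ≃⟨ ℚᵘ.*-cong (toℚᵘ-fromℕ a) (toℚᵘ-fromℕ b) ⟨
  toℚᵘ (fromℕ a) ℚᵘ.* toℚᵘ (fromℕ b)  ≃⟨ ℚ.toℚᵘ-homo-* (fromℕ a) (fromℕ b) ⟨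
  toℚᵘ (fromℕ a * fromℕ b)            ∎)
  where open ℚᵘ.≤-Reasoning

fromℕ-mono-≤ : ∀ {a b} → a ≤ℕ b → fromℕ a ≤ fromℕ b
fromℕ-mono-≤ {a} {b} a≤b = ℚ.toℚᵘ-cancel-≤ (begin
  toℚᵘ (fromℕ a)  ≃⟨ toℚᵘ-fromℕ a ⟩
  ι a             ≤⟨ ℚᵘ.*≤* (ℤ.*-monoʳ-≤-nonNeg (+ 1) (ℤ.+≤+ a≤b)) ⟩
  ι b             ≃⟨ toℚᵘ-fromℕ b ⟨
  toℚᵘ (fromℕ b)  ∎)
  where open ℚᵘ.≤-Reasoning

fromℕ-nonNegative : ∀ n → NonNegative (fromℕ n)
fromℕ-nonNegative n = nonNegative (fromℕ-mono-≤ {0} {n} ℕ.z≤n)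

/-*-cancel : ∀ k r .{{_ : NonZero r}} → (+ k / r) * fromℕ r ≡ fromℕ k
/-*-cancel k r@(suc r-1) = ℚ.toℚᵘ-injective (begin-equality
  toℚᵘ ((+ k / r) * fromℕ r)           ≃⟨ ℚ.toℚᵘ-homo-* (+ k / r) (fromℕ r) ⟩
  toℚᵘ (+ k / r) ℚᵘ.* toℚᵘ (fromℕ r)   ≃⟨ ℚᵘ.*-cong (ℚ.toℚᵘ-fromℚᵘ (ℚᵘ.mkℚᵘ (+ k) r-1)) (toℚᵘ-fromℕ r) ⟩
  ℚᵘ.mkℚᵘ (+ k) r-1 ℚᵘ.* ι r
    ≃⟨ ℚᵘ.*≡* (trans (ℤ.*-identityʳ _) (cong (λ x → + k ℤ.* + x) (sym (ℕ.*-identityʳ r)))) ⟩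
  ι k                                  ≃⟨ toℚᵘ-fromℕ k ⟨
  toℚᵘ (fromℕ k)                       ∎)
  where open ℚᵘ.≤-Reasoning

sum-bound : ∀ {n} (c : ℚ) (f g : Fin n → ℕ) → (∀ i → fromℕ (f i) ≤ c * fromℕ (g i)) →
            fromℕ (sum f) ≤ c * fromℕ (sum g)
sum-bound {zero}  c f g f≤cg = ℚ.≤-reflexive (sym (ℚ.*-zeroʳ c))
sum-bound {suc n} c f g f≤cg = begin
  fromℕ (f zero ℕ.+ sum (f ∘ suc))                    ≡⟨ fromℕ-+ (f zero) _ ⟩
  fromℕ (f zero) + fromℕ (sum (f ∘ suc))
    ≤⟨ ℚ.+-mono-≤ (f≤cg zero) (sum-bound c (f ∘ suc) (g ∘ suc) (f≤cg ∘ suc)) ⟩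
  c * fromℕ (g zero) + c * fromℕ (sum (g ∘ suc))      ≡⟨ ℚ.*-distribˡ-+ c _ _ ⟨
  c * (fromℕ (g zero) + fromℕ (sum (g ∘ suc)))        ≡⟨ cong (c *_) (fromℕ-+ (g zero) _) ⟨
  c * fromℕ (g zero ℕ.+ sum (g ∘ suc))                ∎
  where open ℚ.≤-Reasoning

-- Dividing the degree bound by `r` gives at most 2c/r red hyperedges per red edge. Blue hyperedges
-- have coefficient 1. Raising both coefficients to their maximum `K` lets the two terms be added
-- and compared with `e`.
combine-bounds : ∀ r .{{_ : NonZero r}} (c : ℚ) (reds blues redEdges e : ℕ) →
                 fromℕ (reds ℕ.* r) ≤ c * fromℕ (2 ℕ.* redEdges) → redEdges ℕ.+ blues ≤ℕ e →
                 fromℕ (reds ℕ.+ blues) ≤ (((+ 2 / r) * c) ⊔ 1ℚ) * fromℕ e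
combine-bounds r@(suc _) c reds blues redEdges e degrees edges = begin
  fromℕ (reds ℕ.+ blues)                  ≡⟨ fromℕ-+ reds blues ⟩
  fromℕ reds + fromℕ blues                ≤⟨ ℚ.+-mono-≤ reds-bound blues-bound ⟩
  K * fromℕ redEdges + K * fromℕ blues    ≡⟨ ℚ.*-distribˡ-+ K _ _ ⟨
  K * (fromℕ redEdges + fromℕ blues)      ≡⟨ cong (K *_) (fromℕ-+ redEdges blues) ⟨
  K * fromℕ (redEdges ℕ.+ blues)          ≤⟨ ℚ.*-monoˡ-≤-nonNeg K {{K-nonNegative}} (fromℕ-mono-≤ edges) ⟩
  K * fromℕ e                             ∎
  where
  open ℚ.≤-Reasoning
  q K : ℚ
  q = + 2 / r
  K = (q * c) ⊔ 1ℚ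
  -- The sign of `c` is unknown; `K` is non-negative because it is at least 1.
  K-nonNegative : NonNegative K
  K-nonNegative = nonNegative (ℚ.≤-trans (fromℕ-mono-≤ {0} {1} ℕ.z≤n) (ℚ.p≤q⊔p (q * c) 1ℚ))
  rearrange : ∀ c q r E → c * ((q * r) * E) ≡ ((q * c) * E) * r
  rearrange = solve 4 (λ c q r E → c :* ((q :* r) :* E) := ((q :* c) :* E) :* r) refl
    where open +-*-Solver
  scaled : fromℕ reds * fromℕ r ≤ ((q * c) * fromℕ redEdges) * fromℕ r
  scaled = begin
    fromℕ reds * fromℕ r                      ≡⟨ fromℕ-* reds r ⟨
    fromℕ (reds ℕ.* r)                        ≤⟨ degrees ⟩
    c * fromℕ (2 ℕ.* redEdges)                ≡⟨ cong (c *_) (fromℕ-* 2 redEdges) ⟩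
    c * (fromℕ 2 * fromℕ redEdges)            ≡⟨ cong (λ x → c * (x * fromℕ redEdges)) (/-*-cancel 2 r) ⟨
    c * ((q * fromℕ r) * fromℕ redEdges)      ≡⟨ rearrange c q (fromℕ r) (fromℕ redEdges) ⟩
    ((q * c) * fromℕ redEdges) * fromℕ r      ∎
  reds-bound : fromℕ reds ≤ K * fromℕ redEdges
  reds-bound = ℚ.≤-trans
    (ℚ.*-cancelʳ-≤-pos (fromℕ r) {{ℚ.normalize-pos r 1}} scaled)
    (ℚ.*-monoʳ-≤-nonNeg (fromℕ redEdges) {{fromℕ-nonNegative redEdges}} (ℚ.p≤p⊔q (q * c) 1ℚ))
  blues-bound : fromℕ blues ≤ K * fromℕ blues
  blues-bound = subst (_≤ K * fromℕ blues) (ℚ.*-identityˡ (fromℕ blues))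
    (ℚ.*-monoʳ-≤-nonNeg (fromℕ blues) {{fromℕ-nonNegative blues}} (ℚ.p≤q⊔p (q * c) 1ℚ))

-- Graphs given by sets of pairs.

injective⇒≤length : {A : Set} {k : ℕ} {ys : List A} (f : Fin k → A) → Injective _≡_ _≡_ f →
                    (∀ i → f i ∈ ys) → k ≤ℕ length ys
injective⇒≤length {ys = ys} f f-injective f∈ys = injective⇒≤ {f = index ∘ f∈ys} λ {i} {j} eq →
  f-injective (trans (lookup-index (f∈ys i)) (trans (cong (lookup ys) eq) (sym (lookup-index (f∈ys j)))))

module _ {n : ℕ} {Q : Fin n → Fin n → Set} (Q? : ∀ u w → Dec (Q u w)) where

  -- `Q` is consulted on increasing pairs only, in keeping with `Edge`. It may thus be asymmetric,
  -- as it is for matched pairs, which are stored in increasing order.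
  Joined : Fin n → Fin n → Set
  Joined u w = (u Fin.< w × Q u w) ⊎ (w Fin.< u × Q w u)

  joined? : ∀ u w → Dec (Joined u w)
  joined? u w = ((u <? w) ×-dec Q? u w) ⊎-dec ((w <? u) ×-dec Q? w u)

  fromPairs : Graph n
  fromPairs = record
    { adj       = λ u w → ⌊ joined? u w ⌋
    ; symmetric = λ {u} {w} p → fromWitness {a? = joined? w u} (flip (toWitness {a? = joined? u w} p))
    ; loopless  = λ {u} p → irrefl (toWitness {a? = joined? u u} p)
    }
    where
    flip : ∀ {u w} → Joined u w → Joined w u
    flip (inj₁ p) = inj₂ p
    flip (inj₂ p) = inj₁ p
    irrefl : ∀ {u} → Joined u u → Empty
    irrefl (inj₁ (u<u , _)) = Fin.<-irrefl refl u<u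
    irrefl (inj₂ (u<u , _)) = Fin.<-irrefl refl u<u

  adj⇒joined : ∀ {u w} → T (adj fromPairs u w) → Joined u w
  adj⇒joined {u} {w} = toWitness {a? = joined? u w}

  joined⇒adj : ∀ {u w} → Joined u w → T (adj fromPairs u w)
  joined⇒adj {u} {w} = fromWitness {a? = joined? u w}

  edgeList⇒ : ∀ {u w} → (u , w) ∈ edgeList fromPairs → u Fin.< w × Q u w
  edgeList⇒ uw∈ with ∈-filter⁻ _ {xs = cartesianProduct (allFin n) (allFin n)} uw∈
  ... | _ , u<w , uw with adj⇒joined uw
  ...   | inj₁ p         = p
  ...   | inj₂ (w<u , _) = contradiction w<u (Fin.<-asym u<w)

  edgeList⇐ : ∀ {u w} → u Fin.< w → Q u w → (u , w) ∈ edgeList fromPairs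
  edgeList⇐ u<w q = ∈-filter⁺ _ (∈-cartesianProduct⁺ (∈-allFin _) (∈-allFin _))
                                (u<w , joined⇒adj (inj₁ (u<w , q)))

edgeList-unique : ∀ {n} (G : Graph n) → Unique (edgeList G)
edgeList-unique {n} G = filter⁺ _ (cartesianProduct⁺ (allFin⁺ n) (allFin⁺ n))

edge-≡ : ∀ {n} {G : Graph n} {e e′ : Edge G} → source e ≡ source e′ → target e ≡ target e′ → e ≡ e′
edge-≡ {e = record { ordered = o ; adjacent = a }} {record { ordered = o′ ; adjacent = a′ }} refl refl
  rewrite ℕ.<-irrelevant o o′ | T-irrelevant a a′ = refl

-- Red and blue hyperedges and the graphs they define.

module RedBlue {r n : ℕ} (H : Hypergraph r n) where

  Pair : Set
  Pair = Fin n × Fin n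

  size : ℕ
  size = #hyperedges H

  edge : Fin size → Subset n
  edge = lookup (hyperedges H)

  edge-injective : Injective _≡_ _≡_ edge
  edge-injective = lookup-injective (distinct H)

  edge-size : ∀ a → ∣ edge a ∣ ≡ r
  edge-size a = All.lookup (uniform H) (∈-lookup a)

  -- The order condition makes each two-element set a single vertex of the bipartite graph.
  _Covers_ : Fin size → Pair → Set
  a Covers (u , w) = u Fin.< w × u ∈ₛ edge a × w ∈ₛ edge a

  covers? : ∀ a p → Dec (a Covers p)
  covers? a (u , w) = (u <? w) ×-dec (u ∈? edge a) ×-dec (w ∈? edge a)

  _≟ₚ_ : (p q : Pair) → Dec (p ≡ q)
  _≟ₚ_ = ≡-dec Fin._≟_ Fin._≟_

  search : {P : Pair → Set} → Decidable P → Dec (∃ P)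
  search P? = map′ (λ (u , w , p) → (u , w) , p) (λ ((u , w) , p) → u , w , p)
                   (any? λ u → any? λ w → P? (u , w))

  open König _Covers_ covers? _≟ₚ_ search
  open Decomposition decompose using (matching; red; closed; blue)

  partnerIs? : ∀ u w → Dec (∃[ a ] partner matching a ≡ just (u , w))
  partnerIs? u w = any? λ a → Maybe.≡-dec _≟ₚ_ (partner matching a) (just (u , w))

  inRed? : ∀ u w → Dec (∃[ a ] a ∈ₛ red × u ∈ₛ edge a × w ∈ₛ edge a)
  inRed? u w = any? λ a → (a ∈? red) ×-dec (u ∈? edge a) ×-dec (w ∈? edge a)

  matchedGraph redGraph : Graph n
  matchedGraph = fromPairs partnerIs?
  redGraph     = fromPairs inRed?

  -- That the owner of the pair is itself red matters later: it keeps red edges apart from the pairs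
  -- owned by blue hyperedges.
  red-matched : ∀ {u w} → u Fin.< w → (∃[ a ] a ∈ₛ red × u ∈ₛ edge a × w ∈ₛ edge a) →
                ∃[ a ] a ∈ₛ red × partner matching a ≡ just (u , w)
  red-matched u<w (a , a∈red , u∈ , w∈) = closed a∈red (u<w , u∈ , w∈)

  red⊆matched : ∀ {u w} → T (adj redGraph u w) → T (adj matchedGraph u w)
  red⊆matched {u} {w} uw with adj⇒joined inRed? {u} {w} uw
  ... | inj₁ (u<w , p) = let a , _ , eq = red-matched u<w p in joined⇒adj partnerIs? (inj₁ (u<w , a , eq))
  ... | inj₂ (w<u , p) = let a , _ , eq = red-matched w<u p in joined⇒adj partnerIs? (inj₂ (w<u , a , eq))

  carrier : ∀ {u w} → T (adj matchedGraph u w) →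
            ∃[ a ] (partner matching a ≡ just (u , w) ⊎ partner matching a ≡ just (w , u))
  carrier {u} {w} uw with adj⇒joined partnerIs? {u} {w} uw
  ... | inj₁ (_ , a , eq) = a , inj₁ eq
  ... | inj₂ (_ , a , eq) = a , inj₂ eq

  -- Each edge of the embedded `F` is represented by the hyperedge that owns its image. A hyperedge
  -- owns only one pair, and `ψ` is injective, so distinct edges get distinct hyperedges.
  matched⇒berge : ∀ {k} {F : Graph k} → Embedding F matchedGraph → Berge F H
  matched⇒berge {F = F} ψ = record
    { φ           = map ψ
    ; φ-injective = Embedding.injective ψ
    ; f           = λ e → edge (host e)
    ; f-hyperedge = λ e → ∈-lookup (host e)
    ; f-injective = λ {e} {e′} eq → host-injective e e′ (edge-injective eq)
    ; source∈     = λ e → proj₁ (ends∈ (proj₂ (carried e)))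
    ; target∈     = λ e → proj₂ (ends∈ (proj₂ (carried e)))
    }
    where
    carried : (e : Edge F) → ∃[ a ] (partner matching a ≡ just (map ψ (source e) , map ψ (target e)) ⊎
                                     partner matching a ≡ just (map ψ (target e) , map ψ (source e)))
    carried e = carrier {map ψ (source e)} {map ψ (target e)} (preserves ψ (adjacent e))
    host : Edge F → Fin size
    host = proj₁ ∘ carried
    ends∈ : ∀ {a u w} → partner matching a ≡ just (u , w) ⊎ partner matching a ≡ just (w , u) →
            u ∈ₛ edge a × w ∈ₛ edge a
    ends∈ (inj₁ eq) = proj₂ (sound matching eq)
    ends∈ (inj₂ eq) = let _ , w∈ , u∈ = sound matching eq in u∈ , w∈
    same : ∀ {a u w u′ w′} → partner matching a ≡ just (map ψ u , map ψ w) →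
           partner matching a ≡ just (map ψ u′ , map ψ w′) → u ≡ u′ × w ≡ w′
    same eq eq′ with just-injective (trans (sym eq) eq′)
    ... | pairs = Embedding.injective ψ (cong proj₁ pairs) , Embedding.injective ψ (cong proj₂ pairs)
    -- `ψ` may reverse the order of the ends, so one hyperedge could be read in both orientations;
    -- the increasing order of the ends in `Edge` excludes this.
    crossed : ∀ (e e′ : Edge F) {A : Set} → source e ≡ target e′ → target e ≡ source e′ → A
    crossed e e′ p q = contradiction (subst₂ Fin._<_ p q (ordered e)) (Fin.<-asym (ordered e′))
    host-injective : ∀ e e′ → host e ≡ host e′ → e ≡ e′
    host-injective e e′ eq with host e | carried e .proj₂ | host e′ | carried e′ .proj₂
    host-injective e e′ refl | _ | inj₁ p | _ | inj₁ q = let s , t = same p q in edge-≡ s t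
    host-injective e e′ refl | _ | inj₂ p | _ | inj₂ q = let t , s = same p q in edge-≡ s t
    host-injective e e′ refl | _ | inj₁ p | _ | inj₂ q = let s , t = same p q in crossed e e′ s t
    host-injective e e′ refl | _ | inj₂ p | _ | inj₁ q = let t , s = same p q in crossed e e′ s t

  matched-free : ∀ {k} {F : Graph k} → BergeFree F H → Free F matchedGraph
  matched-free free = free ∘ matched⇒berge

  red-free : ∀ {k} {F : Graph k} → BergeFree F H → Free F redGraph
  red-free free ψ = matched-free free record
    { map       = map ψ
    ; injective = Embedding.injective ψ
    ; preserves = λ {u} {w} uw → red⊆matched {map ψ u} {map ψ w} (preserves ψ uw)
    }

  red-clique : ∀ {a} → a ∈ₛ red → IsClique redGraph (edge a)
  red-clique {a} a∈red {x} {y} x∈ y∈ x≢y with Fin.<-cmp x y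
  ... | tri< x<y _ _ = joined⇒adj inRed? (inj₁ (x<y , a , a∈red , x∈ , y∈))
  ... | tri≈ _ x≡y _ = contradiction x≡y x≢y
  ... | tri> _ _ y<x = joined⇒adj inRed? (inj₂ (y<x , a , a∈red , y∈ , x∈))

  #reds #blues : ℕ
  #reds  = ∣ red ∣
  #blues = ∣ ∁ red ∣

  reds+blues : #reds ℕ.+ #blues ≡ size
  reds+blues = trans (cong (#reds ℕ.+_) (∣∁p∣≡n∸∣p∣ red)) (ℕ.m+[n∸m]≡n (∣p∣≤n red))

  -- Red edges are sent to themselves and blue hyperedges to their partners; this is an injection
  -- into the matched pairs.
  redEdges+blues : #edges redGraph ℕ.+ #blues ≤ℕ #edges matchedGraph
  redEdges+blues = injective⇒≤length (pair ∘ split)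
    (λ {i} {j} eq → trans (sym (join-splitAt (#edges redGraph) #blues i))
      (trans (cong (join (#edges redGraph) #blues) (pair-injective {split i} {split j} eq))
             (join-splitAt (#edges redGraph) #blues j)))
    (λ i → let a , eq = pair-matched (split i) in
           edgeList⇐ partnerIs? (proj₁ (sound matching eq)) (a , eq))
    where
    open Enumeration (enumerateSubset (∁ red))
    split : Fin (#edges redGraph ℕ.+ #blues) → Fin (#edges redGraph) ⊎ Fin #blues
    split = splitAt (#edges redGraph)
    -- No vertex is exempt in the final decomposition, so only saturation remains.
    blue-saturated : ∀ j → Saturated matching (at j)
    blue-saturated j with blue (x∈∁p⇒x∉p (satisfies j))
    ... | inj₁ s = s
    pair : Fin (#edges redGraph) ⊎ Fin #blues → Pair
    pair = [ lookup (edgeList redGraph) , proj₁ ∘ blue-saturated ]′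
    red-carrier : ∀ i → ∃[ a ] a ∈ₛ red × partner matching a ≡ just (lookup (edgeList redGraph) i)
    red-carrier i = let u<w , p = edgeList⇒ inRed? (∈-lookup i) in red-matched u<w p
    pair-matched : ∀ x → ∃[ a ] partner matching a ≡ just (pair x)
    pair-matched (inj₁ i) = let a , _ , eq = red-carrier i in a , eq
    pair-matched (inj₂ j) = at j , proj₂ (blue-saturated j)
    -- A red edge is owned by a red hyperedge, and no pair has two owners.
    red≢blue : ∀ i j → pair (inj₁ i) ≢ pair (inj₂ j)
    red≢blue i j eq = let a , a∈red , a↦ = red-carrier i in
      x∈∁p⇒x∉p (satisfies j)
        (subst (_∈ₛ red) (partner-injective matching a↦
                 (trans (proj₂ (blue-saturated j)) (cong just (sym eq)))) a∈red)
    pair-injective : Injective _≡_ _≡_ pair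
    pair-injective {inj₁ i} {inj₁ j} eq = cong inj₁ (lookup-injective (edgeList-unique redGraph) eq)
    pair-injective {inj₁ i} {inj₂ j} eq = contradiction eq (red≢blue i j)
    pair-injective {inj₂ i} {inj₁ j} eq = contradiction (sym eq) (red≢blue j i)
    pair-injective {inj₂ i} {inj₂ j} eq = cong inj₂ (at-injective (partner-injective matching
      (trans (proj₂ (blue-saturated i)) (cong just eq)) (proj₂ (blue-saturated j))))

  -- Red degrees and the resulting bound.

  redAt? : ∀ u a → Dec (a ∈ₛ red × u ∈ₛ edge a)
  redAt? u a = (a ∈? red) ×-dec (u ∈? edge a)

  redDegree : Fin n → ℕ
  redDegree u = ∑[ a < size ] 𝟙 (redAt? u a)

  -- Incidences between vertices and red hyperedges are counted in two ways, each red hyperedge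
  -- contributing its `r` vertices.
  ∑redDegree : ∑[ u < n ] redDegree u ≡ #reds ℕ.* r
  ∑redDegree = begin
    ∑[ u < n ] ∑[ a < size ] 𝟙 (redAt? u a)    ≡⟨ ∑-comm (λ u a → 𝟙 (redAt? u a)) ⟩
    ∑[ a < size ] ∑[ u < n ] 𝟙 (redAt? u a)    ≡⟨ sum-cong-≗ row ⟩
    ∑[ a < size ] (𝟙 (a ∈? red) ℕ.* r)         ≡⟨ *-distribʳ-sum r (λ a → 𝟙 (a ∈? red)) ⟨
    (∑[ a < size ] 𝟙 (a ∈? red)) ℕ.* r         ≡⟨ cong (ℕ._* r) (∣p∣≡∑𝟙 red) ⟨
    #reds ℕ.* r                                ∎
    where
    open ≡-Reasoning
    row : ∀ a → ∑[ u < n ] 𝟙 (redAt? u a) ≡ 𝟙 (a ∈? red) ℕ.* r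
    row a with a ∈? red
    ... | yes _ = trans (sym (∣p∣≡∑𝟙 (edge a))) (trans (edge-size a) (sym (ℕ.+-identityʳ r)))
    ... | no _  = sum-replicate-zero n

-- A red hyperedge through `u` is a clique of `redGraph` and hence gives a copy in the link. The
-- vertices of that copy together with `u` give the hyperedge back, and hyperedges are distinct as
-- sets.
redCopies : ∀ {k n} (H : Hypergraph (suc k) n) (u : Fin n) → let open RedBlue H in
            DistinctCopies (complete k) (link redGraph u) (redDegree u)
redCopies {k} H u = (λ i → proj₁ (copy i)) , λ {i} {j} (vertices , _) →
  at-injective (edge-injective (⊆-antisym (edge⊆ i j (Equivalence.to ∘ vertices))
                                          (edge⊆ j i (Equivalence.from ∘ vertices))))
  where
  open RedBlue H
  open Enumeration (enumerate (redAt? u))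
  copy : ∀ i → _
  copy i = clique⇒copyInLink redGraph (edge (at i)) (edge-size (at i))
             (λ {x} {y} → red-clique (proj₁ (satisfies i)) {x} {y}) (proj₂ (satisfies i))
  edge⊆ : ∀ i j → (∀ x → VertexOfImage (proj₁ (copy i)) x → VertexOfImage (proj₁ (copy j)) x) →
          ∀ {x} → x ∈ₛ edge (at i) → x ∈ₛ edge (at j)
  edge⊆ i j image⊆ {x} x∈ with Equivalence.to (proj₂ (copy i) x) x∈
  ... | inj₁ x≡u           = Equivalence.from (proj₂ (copy j) x) (inj₁ x≡u)
  ... | inj₂ (y , y∈ , eq) = Equivalence.from (proj₂ (copy j) x) (inj₂ (y , image⊆ y y∈ , eq))

-- The hypothesis on `c` will be applied to graphs of order `degree G u` with the constant `c n`,
-- which requires the order to be at most `n`.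
degree≤n : ∀ {n} (G : Graph n) u → degree G u ≤ℕ n
degree≤n G u = injective⇒≤ (Enumeration.at-injective (neighbours G u))

lemma4 : ∀ {k} (F : Graph (suc k)) (v : Fin (suc k))
    (r : ℕ) .{{_ : NonZero r}} → 2 ≤ℕ r →
    (c : ℕ → ℚ) →
    (∀ n m x → m ≤ℕ n →
    IsExCopies m (complete (r ∸ 1)) (deleteVertex F v) x →
    fromℕ x ≤ c n * fromℕ m) →
    ∀ n N e → IsExBerge r n F N → IsEx n F e →
    fromℕ N ≤ (((+ 2 / r) * c n) ⊔ 1ℚ) * fromℕ e
lemma4 F v r@(suc _) _ c bound n _ e ((H , free , refl) , _) (_ , e-max) =
  subst (λ N → fromℕ N ≤ (((+ 2 / r) * c n) ⊔ 1ℚ) * fromℕ e) reds+blues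
    (combine-bounds r (c n) #reds #blues (#edges redGraph) e
      -- Summing the local bounds over all vertices gives `r` times the red hyperedges on the left
      -- and twice the red edges on the right.
      (subst₂ (λ x y → fromℕ x ≤ c n * fromℕ y) ∑redDegree (handshake redGraph)
        (sum-bound (c n) redDegree (degree redGraph) local))
      -- `matchedGraph` is an `F`-free graph on `n` vertices, so the maximality of `e` bounds its
      -- edges.
      (ℕ.≤-trans redEdges+blues (e-max _ (matchedGraph , matched-free free , refl))))
  where
  open RedBlue H
  local : ∀ u → fromℕ (redDegree u) ≤ c n * fromℕ (degree redGraph u)
  -- The link of `u` is a competitor for the extremal number of order `degree redGraph u`, and it
  -- has `redDegree u` distinct copies.
  local u = decidable-stable (_ ℚ.≤? _) λ ¬bound →
    distinctCopies≤ex (link-free F v redGraph u (red-free free)) (redCopies H u)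
      λ (x , d≤x , isEx) → ¬bound
        (ℚ.≤-trans (fromℕ-mono-≤ d≤x) (bound n _ x (degree≤n redGraph u) isEx))
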